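{- There is a deterministic SP-Greedy algorithm for $\mathrm{OMP}_3(1,1)$ that does not prioritize length-$1$ augmentations and has competitive ratio at most $1/2$. In particular, the direct-first rule cannot be omitted from a guarantee of $3/5$.
   Context: Online bipartite matching: an instance $(G,\pi)$ is a finite bipartite graph $G=(L,R,E)$ and an arrival order $\pi$ of $R$. The offline side $L$ is known in advance; online vertices $j\in R$ arrive one by one in order $\pi$, and upon arrival of $j$ all edges incident to $j$ are revealed. The algorithm maintains a matching $M$, initially empty. A vertex is free if it is currently unmatched. $\mathrm{OMP}_3(s,t)$: upon arrival of $j$, the algorithm either leaves $j$ unmatched (forever, unless matched at this moment) or augments the current matching along an augmenting path of length $1$ or $3$ that starts at $j$ and ends at a free vertex of $L$. A length-1 path $[j~i]$ adds $ji$ with $i\in L$ free. A length-3 path $[j~x~y~i]$, with $x,i\in L$, $y\in R$, $xy\in M$, $i$ free, $jx,yi\in E$, replaces $M$ by $(M\setminus\{xy\})\cup\{jx,yi\}$; then $x$ and $y$ are each said to be reassigned once. Over the execution, each vertex of $L$ may be reassigned at most $s$ times and each vertex of $R$ at most $t$ times. An augmentation is feasible if every vertex it would reassign has not yet reached its budget. An algorithm is SP-Greedy if, upon each arrival $j$, it augments along some feasible path of length 1 or 3 starting at $j$ whenever such a path exists, and otherwise leaves $j$ unmatched. It is direct-first if it is SP-Greedy and uses a length-1 augmentation (direct match) whenever one is available. The competitive ratio of an algorithm is the supremum of $\rho$ such that on every instance $(G,\pi)$ its output matching has size at least $\rho\cdot\nu(G)$, with $\nu(G)$ the maximum matching size of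 $G$. -}

module Defs where

open import Data.Bool.Base using (Bool; T)
open import Data.Empty using (⊥)
open import Data.Fin.Base using (Fin; fromℕ; inject₁)
open import Data.Fin.Permutation using (Permutation′; _⟨$⟩ʳ_)
import Data.Fin.Properties as Fin
open import Data.Integer.Base using (+_)
open import Data.List.Base using (List; []; _∷_; map; filter; length)
open import Data.List.Membership.Propositional using (_∈_; _∉_)
open import Data.List.Relation.Unary.All using (All)
open import Data.List.Relation.Unary.AllPairs using (AllPairs)
open import Data.Maybe using (Maybe; just; nothing; Is-just)
import Data.Maybe.Relation.Unary.Any as Maybe
open import Data.Nat.Base using (ℕ; zero; suc; _≤_; _<_)
open import Data.Product.Base using (Σ; _×_; _,_; proj₁; proj₂; ∃; map₂)
open import Data.Product.Properties using (≡-dec)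
open import Data.Rational.Base as ℚ using (ℚ)
open import Data.Unit.Base using (⊤)
open import Data.Vec.Base using (Vec; lookup; replicate; _∷ʳ_; _[_]%=_)
open import Relation.Binary.Definitions using (DecidableEquality)
open import Relation.Binary.PropositionalEquality using (_≡_; _≢_)
open import Relation.Nullary.Decidable using (¬?)

Graph : ℕ → ℕ → Set
Graph l r = Fin l → Fin r → Bool

Edge : ℕ → ℕ → Set
Edge l r = Fin l × Fin r

_≟ᴱ_ : ∀ {l r} → DecidableEquality (Edge l r)
_≟ᴱ_ = ≡-dec Fin._≟_ Fin._≟_

Disjoint : ∀ {l r} → Edge l r → Edge l r → Set
Disjoint e f = proj₁ e ≢ proj₁ f × proj₂ e ≢ proj₂ f

IsMatching : ∀ {l r} → Graph l r → List (Edge l r) → Set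
IsMatching G M = All (λ e → T (G (proj₁ e) (proj₂ e))) M × AllPairs Disjoint M

IsMatchingNumber : ∀ {l r} → Graph l r → ℕ → Set
IsMatchingNumber G ν =
  (∃ λ M → IsMatching G M × length M ≡ ν) ×
  (∀ M → IsMatching G M → length M ≤ ν)

-- order ⟨$⟩ʳ k is the k-th online vertex to arrive.
record Instance : Set where
  field
    {l r} : ℕ
    graph : Graph l r
    order : Permutation′ r

  arrivals : Graph l r
  arrivals i k = graph i (order ⟨$⟩ʳ k)

-- During an execution the online vertices are named by their arrival times,
-- so a Graph l r is what has been revealed after r arrivals; the two vectors
-- count how often each vertex has been reassigned so far.
record State (l r : ℕ) : Set where
  constructor state
  field
    matching    : List (Edge l r)
    reassignedL : Vec ℕ l
    reassignedR : Vec ℕ r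

open State public

initial : ∀ {l} → State l 0
initial {l} = state [] (replicate l 0) (replicate 0 0)

arrive : ∀ {l r} → State l r → State l (suc r)
arrive (state M a b) = state (map (map₂ inject₁) M) a (b ∷ʳ 0)

Free : ∀ {l r} → State l r → Fin l → Set
Free S i = ∀ y → (i , y) ∉ matching S

-- The feasible augmenting paths [j i] and [j x y i] starting at j, with
-- reassignment budgets s on the offline and t on the online side.
data FeasiblePath (s t : ℕ) {l r : ℕ}
                  (G : Graph l r) (S : State l r) (j : Fin r) : Set where
  length1 : ∀ i → T (G i j) → Free S i → FeasiblePath s t G S j
  length3 : ∀ x y i →
            T (G x j) → (x , y) ∈ matching S → T (G i y) → Free S i →
            lookup (reassignedL S) x < s → lookup (reassignedR S) y < t →
            FeasiblePath s t G S j

augment : ∀ {s t l r} {G : Graph l r} (S : State l r) {j : Fin r} →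
          FeasiblePath s t G S j → State l r
augment (state M a b) {j} (length1 i _ _) = state ((i , j) ∷ M) a b
augment (state M a b) {j} (length3 x y i _ _ _ _ _ _) =
  state ((x , j) ∷ (i , y) ∷ filter (λ e → ¬? (e ≟ᴱ (x , y))) M)
        (a [ x ]%= suc) (b [ y ]%= suc)

-- A deterministic algorithm for OMP₃(s,t). Its decision on the newest online
-- vertex, fromℕ r, may depend on everything revealed so far; nothing means
-- that the vertex is left unmatched.
record Algorithm (s t : ℕ) : Set where
  field
    decide : ∀ {l r} (G : Graph l (suc r)) (S : State l (suc r)) →
             Maybe (FeasiblePath s t G S (fromℕ r))

module _ {s t : ℕ} (A : Algorithm s t) where
  open Algorithm A

  step : ∀ {l r} (G : Graph l (suc r)) → State l (suc r) → State l (suc r)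
  step G S with decide G S
  ... | nothing = S
  ... | just p  = augment S p

  mutual
    run : ∀ {l r} → Graph l r → State l r
    run {r = zero}  G = initial
    run {r = suc r} G = step G (before G)

    -- The state in which the decision on the last vertex of G is made.
    before : ∀ {l r} → Graph l (suc r) → State l (suc r)
    before G = arrive (run (λ i k → G i (inject₁ k)))

  decision : ∀ {l r} (G : Graph l (suc r)) →
             Maybe (FeasiblePath s t G (before G) (fromℕ r))
  decision G = decide G (before G)

  output : (I : Instance) → List (Edge (Instance.l I) (Instance.r I))
  output I = map (map₂ (order ⟨$⟩ʳ_)) (matching (run arrivals))
    where open Instance I

IsLength1 : ∀ {s t l r} {G : Graph l r} {S : State l r} {j : Fin r} →
            FeasiblePath s t G S j → Set
IsLength1 (length1 _ _ _)             = ⊤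
IsLength1 (length3 _ _ _ _ _ _ _ _ _) = ⊥

-- Every revealed graph is a prefix of some instance, so quantifying over G
-- covers exactly the arrivals occurring in executions of the algorithm.
SPGreedy : ∀ {s t} → Algorithm s t → Set
SPGreedy {s} {t} A =
  ∀ {l r} (G : Graph l (suc r)) →
  FeasiblePath s t G (before A G) (fromℕ r) → Is-just (decision A G)

DirectFirst : ∀ {s t} → Algorithm s t → Set
DirectFirst {s} {t} A =
  SPGreedy A ×
  (∀ {l r} (G : Graph l (suc r)) →
   (Σ (FeasiblePath s t G (before A G) (fromℕ r)) IsLength1) →
   Maybe.Any IsLength1 (decision A G))

fromℕℚ : ℕ → ℚ
fromℕℚ n = + n ℚ./ 1

Guarantees : ∀ {s t} → Algorithm s t → ℚ → Set
Guarantees A ρ =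
  ∀ (I : Instance) ν → IsMatchingNumber (Instance.graph I) ν →
  ρ ℚ.* fromℕℚ ν ℚ.≤ fromℕℚ (length (output A I))

-- The competitive ratio is the supremum of the guaranteed ρ, so it is at most c
-- iff c bounds every such ρ. Rational ρ suffice: for real ρ > c guaranteed, every
-- rational between c and ρ is guaranteed too.
CompetitiveRatioAtMost : ∀ {s t} → Algorithm s t → ℚ → Set
CompetitiveRatioAtMost A c = ∀ ρ → Guarantees A ρ → ρ ℚ.≤ c

{-# OPTIONS --safe #-}

-- Take the greedy algorithm that prefers augmenting paths of length 3. On the
-- instance with neighbourhoods {0,1,3}, {0,2}, {0}, {1}, the first vertex is
-- matched to 0, and the second takes 0 by moving the first to 1. Now offline 0
-- and online 0 have exhausted their budgets, so both matched edges, (0,1) and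
-- (1,0) as (offline, online) pairs, are blocked and the last two vertices stay
-- unmatched. The graph has the perfect matching (3,0), (2,1), (0,2), (1,3).
module Submission where

open import Defs
open import Data.Bool.Base using (true; false)
open import Data.Bool.Properties using (T?)
open import Data.Fin.Base using (Fin; fromℕ; inject₁)
open import Data.Fin.Patterns using (0F; 1F; 2F; 3F)
import Data.Fin.Permutation as Permutation
import Data.Fin.Properties as Fin
open import Data.Integer.Base using (+_)
open import Data.List.Base using (List; []; _∷_; length; lookup)
import Data.List.Membership.DecPropositional as DecMembership
open import Data.List.Membership.Propositional.Properties using (∈-lookup)
import Data.List.Relation.Unary.All as All
open import Data.List.Relation.Unary.AllPairs as AllPairs
  using (AllPairs; []; _∷_; allPairs?)
open import Data.Maybe using (Is-just)
open import Data.Maybe.Relation.Unary.Any using (just)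
open import Data.Nat.Base using (ℕ; _≤_)
open import Data.Nat.Properties using (_<?_)
open import Data.Product.Base using (Σ; _×_; _,_; proj₁; proj₂)
open import Data.Rational.Base as ℚ using (_/_; ½)
import Data.Rational.Properties as ℚ
open import Data.Unit.Base using (tt)
import Data.Vec.Base as Vec
open import Function.Definitions using (Injective)
open import Relation.Binary.PropositionalEquality using (_≡_; _≢_; refl; sym)
open import Relation.Nullary.Decidable
  using (Dec; yes; no; ¬?; _×-dec_; map′; dec⇒maybe; from-yes; from-no)
open import Relation.Nullary.Negation using (contradiction)
open import Relation.Nullary.Negation.Core using (¬_)

lookup-injective : ∀ {A B : Set} {f : A → B} {xs} →
                   AllPairs (λ x y → f x ≢ f y) xs →
                   Injective _≡_ _≡_ (λ i → f (lookup xs i))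
lookup-injective (_ ∷ _) {Fin.zero} {Fin.zero} _ = refl
lookup-injective {xs = _ ∷ xs} (x≢ ∷ _) {Fin.zero} {Fin.suc j} eq =
  contradiction eq (All.lookup x≢ (∈-lookup {xs = xs} j))
lookup-injective {xs = _ ∷ xs} (x≢ ∷ _) {Fin.suc i} {Fin.zero} eq =
  contradiction (sym eq) (All.lookup x≢ (∈-lookup {xs = xs} i))
lookup-injective (_ ∷ xs!) {Fin.suc i} {Fin.suc j} eq
  with refl ← lookup-injective xs! eq = refl

-- Offline endpoints of a matching are pairwise distinct, so the positions of `M` inject into
-- `Fin l`. This caps every matching of `hard` at its four offline vertices.
matching-length≤ : ∀ {l r} {G : Graph l r} {M} → IsMatching G M → length M ≤ l
matching-length≤ (_ , disjoint) =
  Fin.injective⇒≤ (lookup-injective (AllPairs.map proj₁ disjoint))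

module _ {l r : ℕ} where
  open DecMembership (_≟ᴱ_ {l} {r}) using (_∈?_)

  free? : (S : State l r) (i : Fin l) → Dec (Free S i)
  free? S i = Fin.all? λ y → ¬? ((i , y) ∈? matching S)

  isMatching? : (G : Graph l r) (M : List (Edge l r)) → Dec (IsMatching G M)
  isMatching? G M =
    All.all? (λ e → T? (G (proj₁ e) (proj₂ e))) M ×-dec
    allPairs? (λ e f → ¬? (proj₁ e Fin.≟ proj₁ f) ×-dec
                       ¬? (proj₂ e Fin.≟ proj₂ f)) M

  module _ {s t : ℕ} (G : Graph l r) (S : State l r) (j : Fin r) where

    length1? : Dec (Σ (FeasiblePath s t G S j) IsLength1)
    length1? = map′
      (λ (i , e , f) → length1 i e f , tt)
      (λ { (length1 i e f , _) → i , e , f })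
      (Fin.any? λ i → T? (G i j) ×-dec free? S i)

    length3? : Dec (Σ (FeasiblePath s t G S j) λ p → ¬ IsLength1 p)
    length3? = map′
      (λ (x , y , i , jx , xy , yi , f , a , b) →
        length3 x y i jx xy yi f a b , λ ())
      (λ { (length1 _ _ _ , ¬l1) → contradiction tt ¬l1
         ; (length3 x y i jx xy yi f a b , _) →
             x , y , i , jx , xy , yi , f , a , b })
      (Fin.any? λ x → Fin.any? λ y → Fin.any? λ i →
        T? (G x j) ×-dec (x , y) ∈? matching S ×-dec T? (G i y) ×-dec
        free? S i ×-dec Vec.lookup (reassignedL S) x <? s ×-dec
        Vec.lookup (reassignedR S) y <? t)

    -- Length 3 is tried first, the priority that `hard` exploits. A `no` refutes feasible paths of
    -- both lengths, which yields SP-Greedy.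
    long-first? : Dec (FeasiblePath s t G S j)
    long-first? with length3? | length1?
    ... | yes (p , _) | _           = yes p
    ... | no _        | yes (p , _) = yes p
    ... | no ¬p       | no ¬q       = no λ where
      p@(length1 _ _ _)             → ¬q (p , tt)
      p@(length3 _ _ _ _ _ _ _ _ _) → ¬p (p , λ ())

dec⇒maybe-just : ∀ {A : Set} (a? : Dec A) → A → Is-just (dec⇒maybe a?)
dec⇒maybe-just (yes _) _ = just tt
dec⇒maybe-just (no ¬a) a = contradiction a ¬a

longFirst : ∀ {s t} → Algorithm s t
longFirst .Algorithm.decide {r = r} G S = dec⇒maybe (long-first? G S (fromℕ r))

longFirst-spGreedy : ∀ {s t} → SPGreedy (longFirst {s} {t})
longFirst-spGreedy {r = r} G =
  dec⇒maybe-just (long-first? G (before longFirst G) (fromℕ r))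

-- The numbering steers the ties: `Fin.any?` returns the least witness, so online 0 takes offline 0
-- and is later moved to 1 rather than 3.
hard : Graph 4 4
hard 0F 0F = true
hard 1F 0F = true
hard 3F 0F = true
hard 0F 1F = true
hard 2F 1F = true
hard 0F 2F = true
hard 1F 3F = true
hard _  _  = false

hardInstance : Instance
hardInstance = record { graph = hard ; order = Permutation.id }

hard-matchingNumber : IsMatchingNumber hard 4
hard-matchingNumber =
  (perfect , from-yes (isMatching? hard perfect) , refl) ,
  λ _ → matching-length≤
  where perfect = (3F , 0F) ∷ (2F , 1F) ∷ (0F , 2F) ∷ (1F , 3F) ∷ []

longFirst-ratio : CompetitiveRatioAtMost {1} {1} longFirst ½
-- Type checking evaluates the run: the output has length 2, and `½ ℚ.* fromℕℚ 4` normalises to the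
-- same rational, so cancelling the factor 4 leaves the bound on `ρ`.
longFirst-ratio ρ guaranteed = ℚ.*-cancelʳ-≤-pos (fromℕℚ 4)
  (guaranteed hardInstance 4 hard-matchingNumber)

firstTwo : Graph 4 2
firstTwo i k = hard i (inject₁ (inject₁ k))

-- When online 1 arrives, its neighbour offline 2 is free, yet the decision evaluates to the path
-- through offline 0, on which `IsLength1` is empty.
longFirst-¬directFirst : ¬ DirectFirst {1} {1} longFirst
longFirst-¬directFirst (_ , direct)
  with just () ← direct firstTwo
    (from-yes (length1? firstTwo (before (longFirst {1} {1}) firstTwo) 1F))

proposition32 : (Σ (Algorithm 1 1) λ A →
    SPGreedy A × (¬ DirectFirst A) × CompetitiveRatioAtMost A ½)
    × (¬ ((A : Algorithm 1 1) → SPGreedy A → Guarantees A (+ 3 / 5)))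
proposition32 =
  (longFirst , longFirst-spGreedy , longFirst-¬directFirst , longFirst-ratio) ,
  -- Applied to `longFirst`, a guarantee for all SP-Greedy algorithms would force 3/5 ≤ 1/2.
  λ guarantee → from-no (+ 3 / 5 ℚ.≤? ½)
    (longFirst-ratio (+ 3 / 5) (guarantee longFirst longFirst-spGreedy))
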